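{- Let $D=\beta^2+4\alpha^2$, where $\alpha,\beta\in\mathbb{N}$ are coprime and $D$ is not a square. Then the negative Pell's equation $x^2-Dy^2=-4$ has integer solutions if and only if the integral binary quadratic form $\alpha x^2+\beta xy-\alpha y^2$ is $\mathrm{GL}_2(\mathbb{Z})$-equivalent to a form of the shape $ax^2+bxy+cy^2$ (with $a,b,c\in\mathbb{Z}$) with $a$ dividing $b$.
   Context: $\mathbb{N}$ denotes the positive integers. $\mathrm{GL}_2(\mathbb{Z})$-equivalence of binary quadratic forms is with respect to $f_T(x,y)=\det(T)^{ -1}f(t_1x+t_2y,t_3x+t_4y)$ for $T=\begin{pmatrix} t_1&t_2\\t_3&t_4\end{pmatrix}\in\mathrm{GL}_2(\mathbb{Z})$. -}

module Defs where

open import Algebra.Definitions using (Invertible)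
open import Data.Integer using (ℤ; _+_; _*_; _-_; _^_; 1ℤ)
open import Data.Nat as ℕ using (ℕ)
open import Data.Product using (∃-syntax; proj₁)
open import Relation.Binary.PropositionalEquality using (_≡_)
open import Relation.Nullary using (¬_)

NonSquare : ℕ → Set
NonSquare n = ¬ (∃[ m ] n ≡ m ℕ.^ 2)

record BinaryQuadraticForm : Set where
  constructor form
  field
    a b c : ℤ

⟦_⟧ : BinaryQuadraticForm → ℤ → ℤ → ℤ
⟦ form a b c ⟧ x y = a * x ^ 2 + b * x * y + c * y ^ 2

record GL₂ℤ : Set where
  field
    t₁ t₂ t₃ t₄ : ℤ

  det : ℤ
  det = t₁ * t₄ - t₂ * t₃

  field
    det-invertible : Invertible _≡_ 1ℤ _*_ det

  det⁻¹ : ℤ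
  det⁻¹ = proj₁ det-invertible

transform : GL₂ℤ → (ℤ → ℤ → ℤ) → ℤ → ℤ → ℤ
transform T f x y = det⁻¹ * f (t₁ * x + t₂ * y) (t₃ * x + t₄ * y)
  where open GL₂ℤ T

-- The equation g = f_T is stated pointwise on ℤ × ℤ.  This is equality of
-- forms, since the values at (1,0), (0,1) and (1,1) determine a, c and b.
GL₂ℤ-Equivalent : BinaryQuadraticForm → BinaryQuadraticForm → Set
GL₂ℤ-Equivalent f g = ∃[ T ] ∀ x y → ⟦ g ⟧ x y ≡ transform T ⟦ f ⟧ x y

{-# OPTIONS --safe #-}

-- Both sides of the equivalence say that f = αx² + βxy − αy² has an automorphism
-- S = (p q; r −p) with trace 0 and det S = −(p² + qr) = −1; invariance of f under such
-- an S amounts to α(q + r) = βp.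
-- As α and β are coprime, the latter forces p = αy and q + r = βy, and then x = q − r
-- solves x² − Dy² = −4.  On the other hand, S fixes a primitive vector v, and in
-- a basis (v , w) it becomes (1 k; 0 −1), whose invariance condition is b = ka.
module Submission where

open import Defs
open import Data.Nat as ℕ using (ℕ; NonZero)
open import Data.Nat.Coprimality using (Coprime)
open import Data.Integer using (ℤ; +_; -_; _*_; _-_; _^_)
open import Data.Integer.Divisibility using (_∣_)
open import Data.Product using (_×_; ∃-syntax)
open import Function.Bundles using (_⇔_)
open import Relation.Binary.PropositionalEquality using (_≡_)

open import Data.Empty using (⊥-elim)
open import Data.Integer using (_+_; ∣_∣; 0ℤ; 1ℤ; -1ℤ; _%ℕ_; _/ℕ_; ≢-nonZero)
open import Data.Integer.Coprimality using (coprime-divisor)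
open import Data.Integer.Divisibility.Signed using (divides; ∣ᵤ⇒∣; ∣⇒∣ᵤ)
open import Data.Integer.DivMod using (a≡a%ℕn+[a/ℕn]*n; n%ℕd<d)
open import Data.Integer.Properties
open import Data.Integer.Tactic.RingSolver using (solve-∀)
open import Data.Nat.GCD using (module GCD; module Bézout)
import Data.Nat.Properties as ℕ
open import Data.Product using (_,_; proj₁; proj₂)
open import Data.Sum using (inj₁; inj₂)
open import Function.Bundles using (mk⇔)
open import Relation.Binary.PropositionalEquality
  using (_≢_; refl; sym; trans; cong; cong₂; module ≡-Reasoning)

-- Integer equations as linear combinations of equations.

private
  variable
    i j i₁ j₁ i₂ j₂ i₃ j₃ : ℤ

-- Reduces an equation to a polynomial identity for the ring solver: the difference of its sides is
-- a combination, with chosen coefficients, of differences that vanish by hypothesis.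
≡-combination₁ : ∀ c → i - j ≡ c * (i₁ - j₁) → i₁ ≡ j₁ → i ≡ j
≡-combination₁ {i} {j} {i₁} c eq refl = i-j≡0⇒i≡j i j (trans eq (zeros c i₁))
  where
  zeros : ∀ c i₁ → c * (i₁ - i₁) ≡ 0ℤ
  zeros = solve-∀

≡-combination₂ : ∀ c c′ → i - j ≡ c * (i₁ - j₁) + c′ * (i₂ - j₂) →
  i₁ ≡ j₁ → i₂ ≡ j₂ → i ≡ j
≡-combination₂ {i} {j} {i₁} {i₂ = i₂} c c′ eq refl refl =
  i-j≡0⇒i≡j i j (trans eq (zeros c c′ i₁ i₂))
  where
  zeros : ∀ c c′ i₁ i₂ → c * (i₁ - i₁) + c′ * (i₂ - i₂) ≡ 0ℤ
  zeros = solve-∀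

≡-combination₃ : ∀ c c′ c″ →
  i - j ≡ c * (i₁ - j₁) + c′ * (i₂ - j₂) + c″ * (i₃ - j₃) →
  i₁ ≡ j₁ → i₂ ≡ j₂ → i₃ ≡ j₃ → i ≡ j
≡-combination₃ {i} {j} {i₁} {i₂ = i₂} {i₃ = i₃} c c′ c″ eq refl refl refl =
  i-j≡0⇒i≡j i j (trans eq (zeros c c′ c″ i₁ i₂ i₃))
  where
  zeros : ∀ c c′ c″ i₁ i₂ i₃ → c * (i₁ - i₁) + c′ * (i₂ - i₂) + c″ * (i₃ - i₃) ≡ 0ℤ
  zeros = solve-∀

-- Signs, units, Bézout and bases of ℤ².

i^2≡i*i : ∀ i → i ^ 2 ≡ i * i
i^2≡i*i i = cong (i *_) (*-identityʳ i)

∣i∣*∣i∣≡i*i : ∀ i → + ∣ i ∣ * + ∣ i ∣ ≡ i * i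
∣i∣*∣i∣≡i*i i with +∣i∣≡i⊎+∣i∣≡-i i
... | inj₁ eq = cong₂ _*_ eq eq
... | inj₂ eq = trans (cong₂ _*_ eq eq) (-i*-i i)
  where
  -i*-i : ∀ i → - i * - i ≡ i * i
  -i*-i = solve-∀

+∣i∣-multiple : ∀ i → ∃[ ε ] + ∣ i ∣ ≡ ε * i
+∣i∣-multiple i with +∣i∣≡i⊎+∣i∣≡-i i
... | inj₁ eq = 1ℤ , trans eq (sym (*-identityˡ i))
... | inj₂ eq = -1ℤ , trans eq (sym (-1*i≡-i i))

i*2≢1 : ∀ i → i * + 2 ≢ 1ℤ
i*2≢1 i eq with ℕ.m*n≡1⇒n≡1 ∣ i ∣ 2 (trans (sym (abs-* i (+ 2))) (cong ∣_∣ eq))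
... | ()

-- `∣ j ∣` is a natural number dividing 1. This disposes of the sign of the determinant in GL₂(ℤ).
i*j≡1⇒j*j≡1 : ∀ i j → i * j ≡ 1ℤ → j * j ≡ 1ℤ
i*j≡1⇒j*j≡1 i j eq = trans (sym (∣i∣*∣i∣≡i*i j)) (cong (λ n → + n * + n) ∣j∣≡1)
  where
  ∣j∣≡1 : ∣ j ∣ ≡ 1
  ∣j∣≡1 = ℕ.m*n≡1⇒n≡1 ∣ i ∣ ∣ j ∣ (trans (sym (abs-* i j)) (cong ∣_∣ eq))

-- The identity over ℕ has two shapes, according to which side carries `d`, and speaks of absolute
-- values. The signs `ε` and `δ` turn both shapes into one signed combination.
bézout : ∀ {d} m n → Bézout.Identity d ∣ m ∣ ∣ n ∣ → ∃[ u ] ∃[ v ] u * m + v * n ≡ + d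
bézout {d} m n identity with +∣i∣-multiple m | +∣i∣-multiple n | identity
... | ε , ∣m∣≡ε*m | δ , ∣n∣≡δ*n | Bézout.+- x y eq =
  + x * ε , - (+ y * δ) , ≡-combination₁ -1ℤ
    (regroup (+ x) (+ y) ε δ m n (+ d))
    (begin
      + d + + y * (δ * n)      ≡⟨ cong (λ k → + d + + y * k) ∣n∣≡δ*n ⟨
      + d + + y * + ∣ n ∣      ≡⟨ cong (λ k → + d + k) (pos-* y ∣ n ∣) ⟨
      + (d ℕ.+ y ℕ.* ∣ n ∣)    ≡⟨ cong +_ eq ⟩
      + (x ℕ.* ∣ m ∣)          ≡⟨ pos-* x ∣ m ∣ ⟩
      + x * + ∣ m ∣            ≡⟨ cong ((+ x) *_) ∣m∣≡ε*m ⟩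
      + x * (ε * m)            ∎)
  where
  open ≡-Reasoning
  regroup : ∀ x y ε δ m n d →
    x * ε * m + - (y * δ) * n - d ≡ -1ℤ * (d + y * (δ * n) - x * (ε * m))
  regroup = solve-∀
... | ε , ∣m∣≡ε*m | δ , ∣n∣≡δ*n | Bézout.-+ x y eq =
  - (+ x * ε) , + y * δ , ≡-combination₁ -1ℤ
    (regroup (+ x) (+ y) ε δ m n (+ d))
    (begin
      + d + + x * (ε * m)      ≡⟨ cong (λ k → + d + + x * k) ∣m∣≡ε*m ⟨
      + d + + x * + ∣ m ∣      ≡⟨ cong (λ k → + d + k) (pos-* x ∣ m ∣) ⟨
      + (d ℕ.+ x ℕ.* ∣ m ∣)    ≡⟨ cong +_ eq ⟩
      + (y ℕ.* ∣ n ∣)          ≡⟨ pos-* y ∣ n ∣ ⟩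
      + y * + ∣ n ∣            ≡⟨ cong ((+ y) *_) ∣n∣≡δ*n ⟩
      + y * (δ * n)            ∎)
  where
  open ≡-Reasoning
  regroup : ∀ x y ε δ m n d →
    - (x * ε) * m + y * δ * n - d ≡ -1ℤ * (d + x * (ε * m) - y * (δ * n))
  regroup = solve-∀

-- Dividing (i , j) by its gcd `g` gives a primitive vector (m , n). If ui + vj = g, cancelling `g`
-- gives um + vn = 1, so (t , s) = (-v , u) completes the basis; `i ≢ 0ℤ` makes `g` cancellable.
unimodular-completion : ∀ i j → i ≢ 0ℤ →
  ∃[ g ] ∃[ m ] ∃[ n ] ∃[ s ] ∃[ t ]
    g ≢ 0ℤ × i ≡ m * g × j ≡ n * g × m * s - t * n ≡ 1ℤ
unimodular-completion i j i≢0 with Bézout.lemma ∣ i ∣ ∣ j ∣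
... | Bézout.result d gcd identity
  with ∣ᵤ⇒∣ {+ d} {i} (proj₁ (GCD.commonDivisor gcd))
     | ∣ᵤ⇒∣ {+ d} {j} (proj₂ (GCD.commonDivisor gcd))
     | bézout i j identity
... | divides m i≡m*d | divides n j≡n*d | u , v , ui+vj≡d =
  + d , m , n , u , - v , d≢0 , i≡m*d , j≡n*d ,
  *-cancelʳ-≡ _ _ (+ d) {{≢-nonZero d≢0}}
    (≡-combination₃ 1ℤ (- u) (- v) (regroup u v m n i j (+ d)) ui+vj≡d i≡m*d j≡n*d)
  where
  d≢0 : + d ≢ 0ℤ
  d≢0 d≡0 = i≢0 (trans i≡m*d (trans (cong (m *_) d≡0) (*-zeroʳ m)))

  regroup : ∀ u v m n i j d →
    (m * u - - v * n) * d - 1ℤ * d ≡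
    1ℤ * (u * i + v * j - d) + - u * (i - m * d) + - v * (j - n * d)
  regroup = solve-∀

-- From a Pell solution to a form with a ∣ b.

⟦⟧-expand : ∀ a b c x y → ⟦ form a b c ⟧ x y ≡ a * (x * x) + b * x * y + c * (y * y)
⟦⟧-expand a b c x y rewrite i^2≡i*i x | i^2≡i*i y = refl

-- With p = αy and r = βy - q, the condition p² + qr = 1 is quadratic in `q` with discriminant Dy² -
-- 4 = x². Its root (x + βy)/2 is an integer by parity.
pell⇒automorphism : ∀ α β x y →
  x * x - (β * β + + 4 * (α * α)) * (y * y) ≡ - (+ 4) →
  ∃[ q ] α * y * (α * y) + q * (β * y - q) ≡ 1ℤ
pell⇒automorphism α β x y pell
  with (x + β * y) %ℕ 2 | n%ℕd<d (x + β * y) 2 | (x + β * y) /ℕ 2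
     | a≡a%ℕn+[a/ℕn]*n (x + β * y) 2
... | 0 | _ | q | even = q , *-cancelˡ-≡ (+ 4) _ _
  (≡-combination₂ -1ℤ (x + + 2 * q - β * y) (regroup α β x y q) pell even)
  where
  regroup : ∀ α β x y q →
    + 4 * (α * y * (α * y) + q * (β * y - q)) - + 4 * 1ℤ ≡
    -1ℤ * (x * x - (β * β + + 4 * (α * α)) * (y * y) - - (+ 4)) +
    (x + + 2 * q - β * y) * (x + β * y - (0ℤ + q * + 2))
  regroup = solve-∀
-- If x + βy is odd, so is x - βy, whereas their product 4α²y² - 4 is even. Substituting x = 2q + 1
-- - βy into the equation displays 1 as twice the integer given here.
... | 1 | _ | q | odd = ⊥-elim (i*2≢1
  (β * y + + 2 * q * (β * y) + + 2 * (α * y * (α * y)) - + 2 * q - + 2 * (q * q) - + 2)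
  (≡-combination₂ -1ℤ (x + 1ℤ + + 2 * q - β * y) (regroup α β x y q) pell odd))
  where
  regroup : ∀ α β x y q →
    (β * y + + 2 * q * (β * y) + + 2 * (α * y * (α * y)) - + 2 * q - + 2 * (q * q) - + 2) * + 2
      - 1ℤ ≡
    -1ℤ * (x * x - (β * β + + 4 * (α * α)) * (y * y) - - (+ 4)) +
    (x + 1ℤ + + 2 * q - β * y) * (x + β * y - (1ℤ + q * + 2))
  regroup = solve-∀
... | ℕ.suc (ℕ.suc _) | ℕ.s≤s (ℕ.s≤s ()) | _ | _

-- Since S² = (p² + qr)I = I, the columns of S + I are fixed by S. The first one, (p + 1 , r), is
-- nonzero by hypothesis, and dividing it by its gcd gives the primitive vector v = (m , n).
automorphism⇒a∣b : ∀ α β p q r → p + 1ℤ ≢ 0ℤ →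
  p * p + q * r ≡ 1ℤ → α * (q + r) ≡ β * p →
  ∃[ a ] ∃[ b ] ∃[ c ] (GL₂ℤ-Equivalent (form α β (- α)) (form a b c) × a ∣ b)
automorphism⇒a∣b α β p q r p+1≢0 det trace
  with unimodular-completion (p + 1ℤ) r p+1≢0
... | g , m , n , s , t , g≢0 , p+1≡mg , r≡ng , ms-tn≡1 =
  a , b , c , (T , equivalent) , ∣⇒∣ᵤ {a} {b} (divides k b≡ka)
  where
  a b c k : ℤ
  a = α * (m * m) + β * m * n - α * (n * n)
  b = + 2 * α * m * t + β * (m * s + t * n) - + 2 * α * n * s
  c = α * (t * t) + β * t * s - α * (s * s)
  -- The coordinate of S w along v is s(pt + qs) - t(rt - ps); p + 1 = mg, r = ng and ms - tn = 1
  -- bring it to this form.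
  k = g * t + q * (s * s) + (p - 1ℤ) * s * t

  T : GL₂ℤ
  T = record
    { t₁ = m ; t₂ = t ; t₃ = n ; t₄ = s
    ; det-invertible = 1ℤ , trans (*-identityˡ _) ms-tn≡1 , trans (*-identityʳ _) ms-tn≡1
    }

  equivalent : ∀ x y → ⟦ form a b c ⟧ x y ≡ transform T ⟦ form α β (- α) ⟧ x y
  equivalent x y = begin
    ⟦ form a b c ⟧ x y
      ≡⟨ ⟦⟧-expand a b c x y ⟩
    a * (x * x) + b * x * y + c * (y * y)
      ≡⟨ regroup α β m n s t x y ⟩
    1ℤ * (α * ((m * x + t * y) * (m * x + t * y)) +
      β * (m * x + t * y) * (n * x + s * y) +
      - α * ((n * x + s * y) * (n * x + s * y)))
      ≡⟨ cong (1ℤ *_) (⟦⟧-expand α β (- α) (m * x + t * y) (n * x + s * y)) ⟨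
    transform T ⟦ form α β (- α) ⟧ x y ∎
    where
    open ≡-Reasoning
    regroup : ∀ α β m n s t x y →
      (α * (m * m) + β * m * n - α * (n * n)) * (x * x) +
      (+ 2 * α * m * t + β * (m * s + t * n) - + 2 * α * n * s) * x * y +
      (α * (t * t) + β * t * s - α * (s * s)) * (y * y) ≡
      1ℤ * (α * ((m * x + t * y) * (m * x + t * y)) +
        β * (m * x + t * y) * (n * x + s * y) +
        - α * ((n * x + s * y) * (n * x + s * y)))
    regroup = solve-∀

  -- The first coordinate of S v = v for v = (m , n).
  fixed₁ : q * n ≡ (1ℤ - p) * m
  fixed₁ = *-cancelʳ-≡ _ _ g {{≢-nonZero g≢0}}
    (≡-combination₃ 1ℤ (1ℤ - p) (- q) (regroup p q r m n g) det p+1≡mg r≡ng)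
    where
    regroup : ∀ p q r m n g →
      q * n * g - (1ℤ - p) * m * g ≡
      1ℤ * (p * p + q * r - 1ℤ) + (1ℤ - p) * (p + 1ℤ - m * g) + - q * (r - n * g)
    regroup = solve-∀

  -- Both sides are mng. The first coordinate takes more: multiplied by `g` it becomes qr = (1 -
  -- p)(1 + p), the determinant condition.
  fixed₂ : r * m ≡ (p + 1ℤ) * n
  fixed₂ = ≡-combination₂ (- n) m (regroup p r m n g) p+1≡mg r≡ng
    where
    regroup : ∀ p r m n g →
      r * m - (p + 1ℤ) * n ≡ - n * (p + 1ℤ - m * g) + m * (r - n * g)
    regroup = solve-∀

  -- The two coordinates of S w = k v − w for w = (t , s).
  km : k * m ≡ (p + 1ℤ) * t + q * s
  km = ≡-combination₃ (- t) (s * t) (q * s) (regroup p q m n g s t) p+1≡mg fixed₁ ms-tn≡1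
    where
    regroup : ∀ p q m n g s t →
      (g * t + q * (s * s) + (p - 1ℤ) * s * t) * m - ((p + 1ℤ) * t + q * s) ≡
      - t * (p + 1ℤ - m * g) + s * t * (q * n - (1ℤ - p) * m) + q * s * (m * s - t * n - 1ℤ)
    regroup = solve-∀

  kn : k * n ≡ r * t - (p - 1ℤ) * s
  kn = ≡-combination₃ (- t) (s * s) ((1ℤ - p) * s) (regroup p q r m n g s t) r≡ng fixed₁ ms-tn≡1
    where
    regroup : ∀ p q r m n g s t →
      (g * t + q * (s * s) + (p - 1ℤ) * s * t) * n - (r * t - (p - 1ℤ) * s) ≡
      - t * (r - n * g) + s * s * (q * n - (1ℤ - p) * m) + (1ℤ - p) * s * (m * s - t * n - 1ℤ)
    regroup = solve-∀

  -- Let N be the bilinear form with matrix (α β; 0 -α), so that N(v,v) = a and N(v,w) + N(w,v) = b.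
  -- Its symmetric part is invariant under S and its alternating part changes sign, hence N(Sx,Sy) =
  -- N(y,x). As Sv = v, N(v, Sw + w) = b, while Sw + w = kv makes it ka.
  b≡ka : b ≡ k * a
  b≡ka = begin
    b
      ≡⟨ ≡-combination₃ (α * t) (β * t - α * s) (m * s - t * n)
           (regroup α β p q r m n s t) fixed₁ fixed₂ trace ⟨
    α * m * ((p + 1ℤ) * t + q * s) + (β * m - α * n) * (r * t - (p - 1ℤ) * s)
      ≡⟨ cong₂ (λ u v → α * m * u + (β * m - α * n) * v) km kn ⟨
    α * m * (k * m) + (β * m - α * n) * (k * n)
      ≡⟨ collect α β m n k ⟩
    k * a ∎
    where
    open ≡-Reasoning
    regroup : ∀ α β p q r m n s t →
      α * m * ((p + 1ℤ) * t + q * s) + (β * m - α * n) * (r * t - (p - 1ℤ) * s)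
        - (+ 2 * α * m * t + β * (m * s + t * n) - + 2 * α * n * s) ≡
      α * t * (q * n - (1ℤ - p) * m) + (β * t - α * s) * (r * m - (p + 1ℤ) * n) +
      (m * s - t * n) * (α * (q + r) - β * p)
    regroup = solve-∀

    collect : ∀ α β m n k →
      α * m * (k * m) + (β * m - α * n) * (k * n) ≡
      k * (α * (m * m) + β * m * n - α * (n * n))
    collect = solve-∀

-- From a form with a ∣ b to a Pell solution.

-- If b = ka, then (x , y) ↦ (x + ky , -y) preserves ax² + bxy + cy². Its conjugate by T preserves
-- f, as the factor `det⁻¹` cancels, and a further sign does no harm to a quadratic form.
a∣b⇒automorphism : ∀ α β a b c →
  GL₂ℤ-Equivalent (form α β (- α)) (form a b c) → a ∣ b →
  ∃[ p ] ∃[ q ] ∃[ r ] p * p + q * r ≡ 1ℤ × α * (q + r) ≡ β * p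
a∣b⇒automorphism α β a b c (T , equivalent) a∣b with ∣ᵤ⇒∣ {a} {b} a∣b
... | divides k b≡ka = p , q , r , trans (det-square t₁ t₂ t₃ t₄ k) det*det≡1 , trace
  where
  open GL₂ℤ T

  -- With Δ = det T, the matrix (p q; r −p) is Δ T (1 k; 0 −1) T⁻¹.
  p q r : ℤ
  p = t₁ * t₄ + t₂ * t₃ - k * t₁ * t₃
  q = k * t₁ * t₁ - + 2 * t₁ * t₂
  r = + 2 * t₃ * t₄ - k * t₃ * t₃

  det⁻¹*det≡1 : det⁻¹ * det ≡ 1ℤ
  det⁻¹*det≡1 = proj₁ (proj₂ det-invertible)

  det*det≡1 : det * det ≡ 1ℤ
  det*det≡1 = i*j≡1⇒j*j≡1 det⁻¹ det det⁻¹*det≡1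

  det-square : ∀ t₁ t₂ t₃ t₄ k →
    (t₁ * t₄ + t₂ * t₃ - k * t₁ * t₃) * (t₁ * t₄ + t₂ * t₃ - k * t₁ * t₃) +
    (k * t₁ * t₁ - + 2 * t₁ * t₂) * (+ 2 * t₃ * t₄ - k * t₃ * t₃) ≡
    (t₁ * t₄ - t₂ * t₃) * (t₁ * t₄ - t₂ * t₃)
  det-square = solve-∀

  values : ∀ x y →
    a * (x * x) + b * x * y + c * (y * y) ≡
    det⁻¹ * (α * ((t₁ * x + t₂ * y) * (t₁ * x + t₂ * y)) +
      β * (t₁ * x + t₂ * y) * (t₃ * x + t₄ * y) +
      - α * ((t₃ * x + t₄ * y) * (t₃ * x + t₄ * y)))
  values x y = begin
    a * (x * x) + b * x * y + c * (y * y)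
      ≡⟨ ⟦⟧-expand a b c x y ⟨
    ⟦ form a b c ⟧ x y
      ≡⟨ equivalent x y ⟩
    det⁻¹ * ⟦ form α β (- α) ⟧ (t₁ * x + t₂ * y) (t₃ * x + t₄ * y)
      ≡⟨ cong (det⁻¹ *_) (⟦⟧-expand α β (- α) (t₁ * x + t₂ * y) (t₃ * x + t₄ * y)) ⟩
    det⁻¹ * (α * ((t₁ * x + t₂ * y) * (t₁ * x + t₂ * y)) +
      β * (t₁ * x + t₂ * y) * (t₃ * x + t₄ * y) +
      - α * ((t₃ * x + t₄ * y) * (t₃ * x + t₄ * y))) ∎
    where open ≡-Reasoning

  a≡ : a ≡ det⁻¹ * (α * (t₁ * t₁) + β * t₁ * t₃ - α * (t₃ * t₃))
  a≡ = ≡-combination₁ 1ℤ (regroup α β a b c t₁ t₂ t₃ t₄ det⁻¹) (values 1ℤ 0ℤ)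
    where
    regroup : ∀ α β a b c t₁ t₂ t₃ t₄ e →
      a - e * (α * (t₁ * t₁) + β * t₁ * t₃ - α * (t₃ * t₃)) ≡
      1ℤ * (a * (1ℤ * 1ℤ) + b * 1ℤ * 0ℤ + c * (0ℤ * 0ℤ) -
        e * (α * ((t₁ * 1ℤ + t₂ * 0ℤ) * (t₁ * 1ℤ + t₂ * 0ℤ)) +
          β * (t₁ * 1ℤ + t₂ * 0ℤ) * (t₃ * 1ℤ + t₄ * 0ℤ) +
          - α * ((t₃ * 1ℤ + t₄ * 0ℤ) * (t₃ * 1ℤ + t₄ * 0ℤ))))
    regroup = solve-∀

  c≡ : c ≡ det⁻¹ * (α * (t₂ * t₂) + β * t₂ * t₄ - α * (t₄ * t₄))
  c≡ = ≡-combination₁ 1ℤ (regroup α β a b c t₁ t₂ t₃ t₄ det⁻¹) (values 0ℤ 1ℤ)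
    where
    regroup : ∀ α β a b c t₁ t₂ t₃ t₄ e →
      c - e * (α * (t₂ * t₂) + β * t₂ * t₄ - α * (t₄ * t₄)) ≡
      1ℤ * (a * (0ℤ * 0ℤ) + b * 0ℤ * 1ℤ + c * (1ℤ * 1ℤ) -
        e * (α * ((t₁ * 0ℤ + t₂ * 1ℤ) * (t₁ * 0ℤ + t₂ * 1ℤ)) +
          β * (t₁ * 0ℤ + t₂ * 1ℤ) * (t₃ * 0ℤ + t₄ * 1ℤ) +
          - α * ((t₃ * 0ℤ + t₄ * 1ℤ) * (t₃ * 0ℤ + t₄ * 1ℤ))))
    regroup = solve-∀

  b≡ : b ≡ det⁻¹ * (+ 2 * α * t₁ * t₂ + β * (t₁ * t₄ + t₂ * t₃) - + 2 * α * t₃ * t₄)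
  b≡ = ≡-combination₃ 1ℤ -1ℤ -1ℤ (regroup α β a b c t₁ t₂ t₃ t₄ det⁻¹) (values 1ℤ 1ℤ) a≡ c≡
    where
    regroup : ∀ α β a b c t₁ t₂ t₃ t₄ e →
      b - e * (+ 2 * α * t₁ * t₂ + β * (t₁ * t₄ + t₂ * t₃) - + 2 * α * t₃ * t₄) ≡
      1ℤ * (a * (1ℤ * 1ℤ) + b * 1ℤ * 1ℤ + c * (1ℤ * 1ℤ) -
        e * (α * ((t₁ * 1ℤ + t₂ * 1ℤ) * (t₁ * 1ℤ + t₂ * 1ℤ)) +
          β * (t₁ * 1ℤ + t₂ * 1ℤ) * (t₃ * 1ℤ + t₄ * 1ℤ) +
          - α * ((t₃ * 1ℤ + t₄ * 1ℤ) * (t₃ * 1ℤ + t₄ * 1ℤ)))) +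
      -1ℤ * (a - e * (α * (t₁ * t₁) + β * t₁ * t₃ - α * (t₃ * t₃))) +
      -1ℤ * (c - e * (α * (t₂ * t₂) + β * t₂ * t₄ - α * (t₄ * t₄)))
    regroup = solve-∀

  -- Inserting `a≡` and `b≡` into ka = b gives `det⁻¹` times α(q + r) - βp equal to 0; multiplying
  -- by `det` removes the unit.
  trace : α * (q + r) ≡ β * p
  trace = ≡-combination₃ (- (det * k)) det (β * p - α * (q + r))
    (regroup α β a k t₁ t₂ t₃ t₄ det⁻¹)
    a≡ (trans (sym b≡ka) b≡) det⁻¹*det≡1
    where
    regroup : ∀ α β a k t₁ t₂ t₃ t₄ e →
      α * (k * t₁ * t₁ - + 2 * t₁ * t₂ + (+ 2 * t₃ * t₄ - k * t₃ * t₃))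
        - β * (t₁ * t₄ + t₂ * t₃ - k * t₁ * t₃) ≡
      - ((t₁ * t₄ - t₂ * t₃) * k) *
        (a - e * (α * (t₁ * t₁) + β * t₁ * t₃ - α * (t₃ * t₃))) +
      (t₁ * t₄ - t₂ * t₃) *
        (k * a - e * (+ 2 * α * t₁ * t₂ + β * (t₁ * t₄ + t₂ * t₃) - + 2 * α * t₃ * t₄)) +
      (β * (t₁ * t₄ + t₂ * t₃ - k * t₁ * t₃) -
        α * (k * t₁ * t₁ - + 2 * t₁ * t₂ + (+ 2 * t₃ * t₄ - k * t₃ * t₃))) *
        (e * (t₁ * t₄ - t₂ * t₃) - 1ℤ)
    regroup = solve-∀

-- By coprimality α ∣ βp gives p = αy, and cancelling α leaves q + r = βy. Then (q - r)² = (q + r)²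
-- - 4qr with qr = 1 - α²y² is Dy² - 4.
automorphism⇒pell : ∀ α β p q r → .{{_ : NonZero α}} → Coprime α β →
  p * p + q * r ≡ 1ℤ → + α * (q + r) ≡ + β * p →
  ∃[ x ] ∃[ y ] x * x - (+ β * + β + + 4 * (+ α * + α)) * (y * y) ≡ - (+ 4)
automorphism⇒pell α β p q r coprime det trace
  with ∣ᵤ⇒∣ {+ α} {p} (coprime-divisor (+ α) (+ β) p coprime
         (∣⇒∣ᵤ {+ α} {+ β * p} (divides (q + r) (trans (sym trace) (*-comm (+ α) (q + r))))))
... | divides y refl = q - r , y ,
  ≡-combination₂ (- (+ 4)) (q + r + + β * y) (regroup (+ α) (+ β) q r y) det q+r≡βy
  where
  q+r≡βy : q + r ≡ + β * y
  q+r≡βy = *-cancelˡ-≡ (+ α) _ _ (trans trace (regroup (+ α) (+ β) y))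
    where
    regroup : ∀ α β y → β * (y * α) ≡ α * (β * y)
    regroup = solve-∀

  regroup : ∀ α β q r y →
    (q - r) * (q - r) - (β * β + + 4 * (α * α)) * (y * y) - - (+ 4) ≡
    - (+ 4) * (y * α * (y * α) + q * r - 1ℤ) + (q + r + β * y) * (q + r - β * y)
  regroup = solve-∀

-- Passage to natural parameters and the equivalence.

+[β²+4α²] : ∀ α β → + (β ℕ.^ 2 ℕ.+ 4 ℕ.* α ℕ.^ 2) ≡ + β * + β + + 4 * (+ α * + α)
+[β²+4α²] α β = cong₂ _+_ (+[n^2] β)
  (trans (pos-* 4 (α ℕ.^ 2)) (cong ((+ 4) *_) (+[n^2] α)))
  where
  +[n^2] : ∀ n → + (n ℕ.^ 2) ≡ + n * + n
  +[n^2] n = trans (cong (λ k → + (n ℕ.* k)) (ℕ.*-identityʳ n)) (pos-* n n)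

theorem1p4 : ∀ (α β D : ℕ) → .{{_ : NonZero α}} → .{{_ : NonZero β}} →
    D ≡ β ℕ.^ 2 ℕ.+ 4 ℕ.* α ℕ.^ 2 →
    Coprime α β →
    NonSquare D →
    (∃[ x ] ∃[ y ] x ^ 2 - + D * y ^ 2 ≡ - (+ 4))
    ⇔
    (∃[ a ] ∃[ b ] ∃[ c ] (GL₂ℤ-Equivalent (form (+ α) (+ β) (- (+ α))) (form a b c) × a ∣ b))
theorem1p4 α β D D≡ coprime _ = mk⇔ to from
  where
  d : ℤ
  d = + β * + β + + 4 * (+ α * + α)

  pell-expand : ∀ x y → x ^ 2 - + D * y ^ 2 ≡ x * x - d * (y * y)
  pell-expand x y =
    cong₂ _-_ (i^2≡i*i x) (cong₂ _*_ (trans (cong +_ D≡) (+[β²+4α²] α β)) (i^2≡i*i y))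

  to : ∃[ x ] ∃[ y ] x ^ 2 - + D * y ^ 2 ≡ - (+ 4) →
    ∃[ a ] ∃[ b ] ∃[ c ] (GL₂ℤ-Equivalent (form (+ α) (+ β) (- (+ α))) (form a b c) × a ∣ b)
  to (x , y , pell) =
    let q , det = pell⇒automorphism (+ α) (+ β) x (+ ∣ y ∣)
          (trans (cong (λ y² → x * x - d * y²) (∣i∣*∣i∣≡i*i y))
            (trans (sym (pell-expand x y)) pell))
    in
    automorphism⇒a∣b (+ α) (+ β) (+ α * + ∣ y ∣) q (+ β * + ∣ y ∣ - q) p+1≢0 det
      (regroup (+ α) (+ β) (+ ∣ y ∣) q)
    where
    -- Replacing y by ∣ y ∣ makes p ≥ 0, so that (p + 1 , r) is a nonzero fixed vector of S.
    p+1≢0 : + α * + ∣ y ∣ + 1ℤ ≢ 0ℤ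
    p+1≢0 eq = ℕ.m+1+n≢0 (α ℕ.* ∣ y ∣)
      (+-injective (trans (cong (_+ 1ℤ) (pos-* α ∣ y ∣)) eq))

    regroup : ∀ α β y q → α * (q + (β * y - q)) ≡ β * (α * y)
    regroup = solve-∀

  from : ∃[ a ] ∃[ b ] ∃[ c ]
      (GL₂ℤ-Equivalent (form (+ α) (+ β) (- (+ α))) (form a b c) × a ∣ b) →
    ∃[ x ] ∃[ y ] x ^ 2 - + D * y ^ 2 ≡ - (+ 4)
  from (a , b , c , equivalent , a∣b) =
    let p , q , r , det , trace = a∣b⇒automorphism (+ α) (+ β) a b c equivalent a∣b
        x , y , pell = automorphism⇒pell α β p q r coprime det trace
    in x , y , trans (pell-expand x y) pell
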